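{- For every integer $n\ge 4$ there exist four weighted directed graphs $w_1,w_2,w_3,w_4:[n]^{(2)}\to\mathbb R$ such that $w_i([n])=0$ and $\|w_i\|_1=n(n-1)$ for every $i\in\{1,2,3,4\}$, and such that for all $1\le i<j\le 4$ $$\operatorname{disc}(w_i,w_j)=0.$$
   Context: Write $[n]=\{1,\dots,n\}$ and let $[n]^{(2)}=\{(x,y)\in[n]\times[n]:x\ne y\}$ be the set of ordered pairs of distinct vertices. A weighted directed graph on $[n]$ is a function $w:[n]^{(2)}\to\mathbb R$, with values written $w_{xy}$. For weighted directed graphs $w,u$ on $[n]$ put $\langle w,u\rangle=\sum_{x\ne y}w_{xy}u_{xy}$, $\|w\|_1=\sum_{x\ne y}|w_{xy}|$, $w([n])=\sum_{x\ne y}w_{xy}$ (sums over ordered pairs of distinct vertices), and $d(w)=w([n])/(n(n-1))$. For a permutation $\pi\in S_n$ the relabelling $w_\pi$ is $(w_\pi)_{xy}=w_{\pi^{ -1}(x)\pi^{ -1}(y)}$. Define $$\operatorname{disc}^+(w,u)=\max_{\pi\in S_n}\langle w_\pi,u\rangle-d(w)d(u)n(n-1),\qquad \operatorname{disc}^-(w,u)=d(w)d(u)n(n-1)-\min_{\pi\in S_n}\langle w_\pi,u\rangle,$$ and $\operatorname{disc}(w,u)=\max\{\operatorname{disc}^+(w,u),\operatorname{disc}^-(w,u)\}$. -}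

module Defs where

open import Algebra.Bundles using (CommutativeRing)
open import Algebra.Structures using (IsCommutativeRing)
open import Data.Fin.Base using (Fin; zero; suc; punchIn)
open import Data.Fin.Permutation
  using (Permutation′; _⟨$⟩ʳ_; _⟨$⟩ˡ_; id; flip; insert; remove; insert-remove)
  renaming (_≈_ to _≈ₚ_)
import Data.Fin.Properties as Fin
import Data.Integer.Base as ℤ
open import Data.List.Base using (List; [_]; allFin; concatMap; foldr; map)
open import Data.List.Membership.Propositional using (_∈_; lose)
open import Data.List.Membership.Propositional.Properties
  using (∈-allFin; ∈-concatMap⁺; ∈-map⁺)
open import Data.List.Relation.Unary.Any using (here)
open import Data.Nat.Base as ℕ using (ℕ; NonTrivial)
import Data.Nat.Properties as ℕ
open import Data.Product using (∃-syntax; _×_; _,_)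
open import Data.Rational.Base as ℚ using (ℚ; 0ℚ; 1ℚ; ½)
import Data.Rational.Properties as ℚ
open import Data.Rational.Solver using (module +-*-Solver)
open import Data.Sum.Base using (inj₁; inj₂)
open import Function.Bundles using (Injection)
open import Function.Properties.Inverse using (↔⇒↣)
open import Level using (0ℓ)
open import Relation.Binary.PropositionalEquality
  using (_≡_; _≢_; refl; sym; trans; cong; cong₂; subst; subst₂)
open import Relation.Nullary using (Dec; yes; no)

------------------------------------------------------------------------
-- Real numbers: Cauchy sequences of rationals, with the setoid equality
-- "the difference tends to 0".

Cauchy : (ℕ → ℚ) → Set
Cauchy s = ∀ ε → 0ℚ ℚ.< ε →
  ∃[ N ] ∀ m n → N ℕ.≤ m → N ℕ.≤ n → ℚ.∣ s m ℚ.- s n ∣ ℚ.< ε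

record ℝ : Set where
  constructor mkℝ
  field
    seq    : ℕ → ℚ
    cauchy : Cauchy seq
open ℝ public

infix 4 _≈_

-- A record rather than a function, so that x and y can be inferred
-- from x ≈ y.
record _≈_ (x y : ℝ) : Set where
  constructor mk≈
  field
    close : ∀ ε → 0ℚ ℚ.< ε →
      ∃[ N ] ∀ n → N ℕ.≤ n → ℚ.∣ seq x n ℚ.- seq y n ∣ ℚ.< ε
open _≈_ public

private
  open +-*-Solver using (solve; _:=_; _:+_; _:*_; :-_; _:-_)

  ≤ˡ : ∀ {p q r} → p ≡ q → p ℚ.≤ r → q ℚ.≤ r
  ≤ˡ refl h = h

  |≤|ˡ : ∀ {p q r} → p ≡ q → ℚ.∣ p ∣ ℚ.≤ r → ℚ.∣ q ∣ ℚ.≤ r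
  |≤|ˡ refl h = h

  <ʳ : ∀ {p q r} → q ≡ r → p ℚ.< q → p ℚ.< r
  <ʳ refl h = h

  |p-p|≡0 : ∀ p → ℚ.∣ p ℚ.- p ∣ ≡ 0ℚ
  |p-p|≡0 p = cong ℚ.∣_∣ (ℚ.+-inverseʳ p)

  |p-q|≡|q-p| : ∀ p q → ℚ.∣ p ℚ.- q ∣ ≡ ℚ.∣ q ℚ.- p ∣
  |p-q|≡|q-p| p q = trans
    (cong ℚ.∣_∣ (solve 2 (λ a b → a :- b := :- (b :- a)) refl p q))
    (ℚ.∣-p∣≡∣p∣ (q ℚ.- p))

  p≤|p| : ∀ p → p ℚ.≤ ℚ.∣ p ∣
  p≤|p| p with ℚ.≤-total 0ℚ p
  ... | inj₁ 0≤p = ℚ.≤-reflexive (sym (ℚ.0≤p⇒∣p∣≡p 0≤p))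
  ... | inj₂ p≤0 = ℚ.≤-trans p≤0 (ℚ.0≤∣p∣ p)

  |p|≤ : ∀ {p e} → p ℚ.≤ e → ℚ.- p ℚ.≤ e → ℚ.∣ p ∣ ℚ.≤ e
  |p|≤ {p} p≤e -p≤e with ℚ.∣p∣≡p∨∣p∣≡-p p
  ... | inj₁ eq = ≤ˡ (sym eq) p≤e
  ... | inj₂ eq = ≤ˡ (sym eq) -p≤e

  |p-q|≤ : ∀ {p q e} → p ℚ.≤ q ℚ.+ e → q ℚ.≤ p ℚ.+ e → ℚ.∣ p ℚ.- q ∣ ℚ.≤ e
  |p-q|≤ {p} {q} {e} h k = |p|≤
    (subst (p ℚ.- q ℚ.≤_) (solve 2 (λ q e → (q :+ e) :- q := e) refl q e)
      (ℚ.+-monoˡ-≤ (ℚ.- q) h))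
    (subst₂ ℚ._≤_ (solve 2 (λ p q → q :- p := :- (p :- q)) refl p q)
      (solve 2 (λ p e → (p :+ e) :- p := e) refl p e)
      (ℚ.+-monoˡ-≤ (ℚ.- p) k))

  p≤q+|p-q| : ∀ p q → p ℚ.≤ q ℚ.+ ℚ.∣ p ℚ.- q ∣
  p≤q+|p-q| p q =
    ≤ˡ (solve 2 (λ p q → q :+ (p :- q) := p) refl p q)
      (ℚ.+-monoʳ-≤ q (p≤|p| (p ℚ.- q)))

  p≤p+ : ∀ {p e} → 0ℚ ℚ.≤ e → p ℚ.≤ p ℚ.+ e
  p≤p+ {p} 0≤e = ≤ˡ (ℚ.+-identityʳ p) (ℚ.+-monoʳ-≤ p 0≤e)

  p≤e+p : ∀ {p e} → 0ℚ ℚ.≤ e → p ℚ.≤ e ℚ.+ p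
  p≤e+p {p} {e} 0≤e = subst (p ℚ.≤_) (ℚ.+-comm p e) (p≤p+ 0≤e)

  triangle : ∀ p q r → ℚ.∣ p ℚ.- r ∣ ℚ.≤ ℚ.∣ p ℚ.- q ∣ ℚ.+ ℚ.∣ q ℚ.- r ∣
  triangle p q r =
    |≤|ˡ
      (solve 3 (λ p q r → (p :- q) :+ (q :- r) := p :- r) refl p q r)
      (ℚ.∣p+q∣≤∣p∣+∣q∣ (p ℚ.- q) (q ℚ.- r))

  0<½ : 0ℚ ℚ.< ½
  0<½ = ℚ.positive⁻¹ ½

  0<½* : ∀ {ε} → 0ℚ ℚ.< ε → 0ℚ ℚ.< ½ ℚ.* ε
  0<½* {ε} 0<ε = ℚ.positive⁻¹ (½ ℚ.* ε) {{ℚ.pos*pos⇒pos ½ ε {{ℚ.positive 0<ε}}}}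

  halves : ∀ ε → ½ ℚ.* ε ℚ.+ ½ ℚ.* ε ≡ ε
  halves ε = trans (sym (ℚ.*-distribʳ-+ ε ½ ½)) (ℚ.*-identityˡ ε)

  +-<-halves : ∀ {a b ε} → a ℚ.< ½ ℚ.* ε → b ℚ.< ½ ℚ.* ε → a ℚ.+ b ℚ.< ε
  +-<-halves {ε = ε} a< b< = <ʳ (halves ε) (ℚ.+-mono-< a< b<)

  NonExpansive₁ : (ℚ → ℚ) → Set
  NonExpansive₁ f = ∀ p q → ℚ.∣ f p ℚ.- f q ∣ ℚ.≤ ℚ.∣ p ℚ.- q ∣

  NonExpansive₂ : (ℚ → ℚ → ℚ) → Set
  NonExpansive₂ f = ∀ p q p′ q′ →
    ℚ.∣ f p q ℚ.- f p′ q′ ∣ ℚ.≤ ℚ.∣ p ℚ.- p′ ∣ ℚ.+ ℚ.∣ q ℚ.- q′ ∣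

  abstract
    cauchy₁ : ∀ f → NonExpansive₁ f → (x : ℝ) → Cauchy (λ n → f (seq x n))
    cauchy₁ f ne x ε 0<ε with cauchy x ε 0<ε
    ... | N , h = N , λ m n N≤m N≤n → ℚ.≤-<-trans (ne (seq x m) (seq x n)) (h m n N≤m N≤n)

  cong₁ : ∀ f (ne : NonExpansive₁ f) x y → x ≈ y →
    mkℝ (λ n → f (seq x n)) (cauchy₁ f ne x) ≈
    mkℝ (λ n → f (seq y n)) (cauchy₁ f ne y)
  cong₁ f ne x y x≈y .close ε 0<ε with close x≈y ε 0<ε
  ... | N , h = N , λ n N≤n → ℚ.≤-<-trans (ne (seq x n) (seq y n)) (h n N≤n)

  abstract
    cauchy₂ : ∀ f → NonExpansive₂ f → (x y : ℝ) →
      Cauchy (λ n → f (seq x n) (seq y n))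
    cauchy₂ f ne x y ε 0<ε
      with cauchy x (½ ℚ.* ε) (0<½* 0<ε) | cauchy y (½ ℚ.* ε) (0<½* 0<ε)
    ... | M , h | N , k = M ℕ.⊔ N , λ m n ≤m ≤n → ℚ.≤-<-trans
      (ne (seq x m) (seq y m) (seq x n) (seq y n))
      (+-<-halves
        (h m n (ℕ.m⊔n≤o⇒m≤o M N ≤m) (ℕ.m⊔n≤o⇒m≤o M N ≤n))
        (k m n (ℕ.m⊔n≤o⇒n≤o M N ≤m) (ℕ.m⊔n≤o⇒n≤o M N ≤n)))

  cong₂′ : ∀ f (ne : NonExpansive₂ f) x x′ y y′ → x ≈ x′ → y ≈ y′ →
    mkℝ (λ n → f (seq x n) (seq y n)) (cauchy₂ f ne x y) ≈
    mkℝ (λ n → f (seq x′ n) (seq y′ n)) (cauchy₂ f ne x′ y′)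
  cong₂′ f ne x x′ y y′ x≈ y≈ .close ε 0<ε
    with close x≈ (½ ℚ.* ε) (0<½* 0<ε) | close y≈ (½ ℚ.* ε) (0<½* 0<ε)
  ... | M , h | N , k = M ℕ.⊔ N , λ n ≤n → ℚ.≤-<-trans
    (ne (seq x n) (seq y n) (seq x′ n) (seq y′ n))
    (+-<-halves (h n (ℕ.m⊔n≤o⇒m≤o M N ≤n)) (k n (ℕ.m⊔n≤o⇒n≤o M N ≤n)))

  abstract
    neg-ne : NonExpansive₁ (λ p → ℚ.- p)
    neg-ne p q = ℚ.≤-reflexive (trans
      (cong ℚ.∣_∣ (solve 2 (λ p q → (:- p) :- (:- q) := :- (p :- q)) refl p q))
      (ℚ.∣-p∣≡∣p∣ (p ℚ.- q)))

  abstract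
    abs-ne : NonExpansive₁ ℚ.∣_∣
    abs-ne p q = |p-q|≤ (half p q)
      (subst (λ z → ℚ.∣ q ∣ ℚ.≤ ℚ.∣ p ∣ ℚ.+ z) (|p-q|≡|q-p| q p) (half q p))
      where
      half : ∀ p q → ℚ.∣ p ∣ ℚ.≤ ℚ.∣ q ∣ ℚ.+ ℚ.∣ p ℚ.- q ∣
      half p q = |≤|ˡ
        (solve 2 (λ p q → q :+ (p :- q) := p) refl p q)
        (ℚ.∣p+q∣≤∣p∣+∣q∣ q (p ℚ.- q))

  abstract
    +-ne : NonExpansive₂ ℚ._+_
    +-ne p q p′ q′ = |≤|ˡ
      (solve 4 (λ p q p′ q′ → (p :- p′) :+ (q :- q′) := (p :+ q) :- (p′ :+ q′))
        refl p q p′ q′)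
      (ℚ.∣p+q∣≤∣p∣+∣q∣ (p ℚ.- p′) (q ℚ.- q′))

  swap-sides : ∀ p q p′ q′ → ℚ.∣ p′ ℚ.- p ∣ ℚ.+ ℚ.∣ q′ ℚ.- q ∣
    ≡ ℚ.∣ p ℚ.- p′ ∣ ℚ.+ ℚ.∣ q ℚ.- q′ ∣
  swap-sides p q p′ q′ = cong₂ ℚ._+_ (|p-q|≡|q-p| p′ p) (|p-q|≡|q-p| q′ q)

  boundˡ : ∀ p q p′ q′ → p ℚ.≤ p′ ℚ.+ (ℚ.∣ p ℚ.- p′ ∣ ℚ.+ ℚ.∣ q ℚ.- q′ ∣)
  boundˡ p q p′ q′ = ℚ.≤-trans (p≤q+|p-q| p p′)
    (ℚ.+-monoʳ-≤ p′ (p≤p+ (ℚ.0≤∣p∣ (q ℚ.- q′))))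

  boundʳ : ∀ p q p′ q′ → q ℚ.≤ q′ ℚ.+ (ℚ.∣ p ℚ.- p′ ∣ ℚ.+ ℚ.∣ q ℚ.- q′ ∣)
  boundʳ p q p′ q′ = ℚ.≤-trans (p≤q+|p-q| q q′)
    (ℚ.+-monoʳ-≤ q′ (p≤e+p (ℚ.0≤∣p∣ (p ℚ.- p′))))

  abstract
    ⊔-ne : NonExpansive₂ ℚ._⊔_
    ⊔-ne p q p′ q′ = |p-q|≤ (half p q p′ q′)
      (subst (λ z → p′ ℚ.⊔ q′ ℚ.≤ p ℚ.⊔ q ℚ.+ z) (swap-sides p q p′ q′)
        (half p′ q′ p q))
      where
      half : ∀ p q p′ q′ →
        p ℚ.⊔ q ℚ.≤ p′ ℚ.⊔ q′ ℚ.+ (ℚ.∣ p ℚ.- p′ ∣ ℚ.+ ℚ.∣ q ℚ.- q′ ∣)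
      half p q p′ q′ = ℚ.⊔-lub
        (ℚ.≤-trans (boundˡ p q p′ q′) (ℚ.+-monoˡ-≤ _ (ℚ.p≤p⊔q p′ q′)))
        (ℚ.≤-trans (boundʳ p q p′ q′) (ℚ.+-monoˡ-≤ _ (ℚ.p≤q⊔p p′ q′)))

  abstract
    ⊓-ne : NonExpansive₂ ℚ._⊓_
    ⊓-ne p q p′ q′ = |p-q|≤ (half p q p′ q′)
      (subst (λ z → p′ ℚ.⊓ q′ ℚ.≤ p ℚ.⊓ q ℚ.+ z) (swap-sides p q p′ q′)
        (half p′ q′ p q))
      where
      half : ∀ p q p′ q′ →
        p ℚ.⊓ q ℚ.≤ p′ ℚ.⊓ q′ ℚ.+ (ℚ.∣ p ℚ.- p′ ∣ ℚ.+ ℚ.∣ q ℚ.- q′ ∣)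
      half p q p′ q′
        with p′ ℚ.⊓ q′ | ℚ.⊓-sel p′ q′
      ... | _ | inj₁ refl = ℚ.≤-trans (ℚ.p⊓q≤p p q) (boundˡ p q p′ q′)
      ... | _ | inj₂ refl = ℚ.≤-trans (ℚ.p⊓q≤q p q) (boundʳ p q p′ q′)

  Bounded : (ℕ → ℚ) → Set
  Bounded s = ∃[ B ] 0ℚ ℚ.< B × ∃[ N ] ∀ n → N ℕ.≤ n → ℚ.∣ s n ∣ ℚ.≤ B

  bounded : (x : ℝ) → Bounded (seq x)
  bounded x with cauchy x 1ℚ (ℚ.positive⁻¹ 1ℚ)
  ... | N , h = ℚ.∣ s N ∣ ℚ.+ 1ℚ
      , ℚ.+-mono-≤-< (ℚ.0≤∣p∣ (s N)) (ℚ.positive⁻¹ 1ℚ)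
      , N
      , λ n N≤n → ℚ.≤-trans
          (|≤|ˡ
            (solve 2 (λ a b → b :+ (a :- b) := a) refl (s n) (s N))
            (ℚ.∣p+q∣≤∣p∣+∣q∣ (s N) (s n ℚ.- s N)))
          (ℚ.+-monoʳ-≤ ℚ.∣ s N ∣ (ℚ.<⇒≤ (h n N N≤n ℕ.≤-refl)))
    where s = seq x

  shrink : ∀ B ε → 0ℚ ℚ.< B → 0ℚ ℚ.< ε → ∃[ δ ] 0ℚ ℚ.< δ × B ℚ.* δ ≡ ½ ℚ.* ε
  shrink B ε 0<B 0<ε = B⁻¹ ℚ.* (½ ℚ.* ε)
    , ℚ.positive⁻¹ _ {{ℚ.pos*pos⇒pos B⁻¹ {{ℚ.1/pos⇒pos B}} (½ ℚ.* ε)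
                         {{ℚ.positive (0<½* 0<ε)}}}}
    , trans (sym (ℚ.*-assoc B B⁻¹ (½ ℚ.* ε)))
        (trans (cong (ℚ._* (½ ℚ.* ε)) (ℚ.*-inverseʳ B {{ℚ.pos⇒nonZero B}}))
          (ℚ.*-identityˡ (½ ℚ.* ε)))
    where
    instance
      B-pos : ℚ.Positive B
      B-pos = ℚ.positive 0<B
    B⁻¹ : ℚ
    B⁻¹ = ℚ.1/_ B {{ℚ.pos⇒nonZero B}}

  |p*q|< : ∀ {p q B δ} → 0ℚ ℚ.< B → ℚ.∣ p ∣ ℚ.≤ B → ℚ.∣ q ∣ ℚ.< δ →
    ℚ.∣ p ℚ.* q ∣ ℚ.< B ℚ.* δ
  |p*q|< {p} {q} {B} {δ} 0<B p≤ q< = subst (ℚ._< B ℚ.* δ)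
    (sym (ℚ.∣p*q∣≡∣p∣*∣q∣ p q))
    (ℚ.≤-<-trans
      (ℚ.*-monoʳ-≤-nonNeg ℚ.∣ q ∣ {{ℚ.∣-∣-nonNeg q}} p≤)
      (ℚ.*-monoʳ-<-pos B {{ℚ.positive 0<B}} q<))

  product-close : ∀ {p q p′ q′ B C β γ ε} → 0ℚ ℚ.< B → 0ℚ ℚ.< C →
    B ℚ.* β ≡ ½ ℚ.* ε → C ℚ.* γ ≡ ½ ℚ.* ε →
    ℚ.∣ p ∣ ℚ.≤ B → ℚ.∣ q′ ∣ ℚ.≤ C →
    ℚ.∣ q ℚ.- q′ ∣ ℚ.< β → ℚ.∣ p ℚ.- p′ ∣ ℚ.< γ →
    ℚ.∣ p ℚ.* q ℚ.- p′ ℚ.* q′ ∣ ℚ.< ε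
  product-close {p} {q} {p′} {q′} 0<B 0<C Bβ Cγ p≤ q′≤ q-q′ p-p′ =
    ℚ.≤-<-trans
      (|≤|ˡ
        (solve 4 (λ p q p′ q′ →
            p :* (q :- q′) :+ q′ :* (p :- p′) := p :* q :- p′ :* q′)
          refl p q p′ q′)
        (ℚ.∣p+q∣≤∣p∣+∣q∣ (p ℚ.* (q ℚ.- q′)) (q′ ℚ.* (p ℚ.- p′))))
      (+-<-halves
        (<ʳ Bβ (|p*q|< 0<B p≤ q-q′))
        (<ʳ Cγ (|p*q|< 0<C q′≤ p-p′)))

  max₄ : ∀ {a b c d n} → (a ℕ.⊔ b) ℕ.⊔ (c ℕ.⊔ d) ℕ.≤ n →
    (a ℕ.≤ n × b ℕ.≤ n) × (c ℕ.≤ n × d ℕ.≤ n)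
  max₄ {a} {b} {c} {d} h =
    (ℕ.m⊔n≤o⇒m≤o a b ab , ℕ.m⊔n≤o⇒n≤o a b ab) ,
    (ℕ.m⊔n≤o⇒m≤o c d cd , ℕ.m⊔n≤o⇒n≤o c d cd)
    where
    ab = ℕ.m⊔n≤o⇒m≤o (a ℕ.⊔ b) (c ℕ.⊔ d) h
    cd = ℕ.m⊔n≤o⇒n≤o (a ℕ.⊔ b) (c ℕ.⊔ d) h

  abstract
    *-cauchy : (x y : ℝ) → Cauchy (λ n → seq x n ℚ.* seq y n)
    *-cauchy x y ε 0<ε =
      let B , 0<B , M , x≤ = bounded x
          C , 0<C , N , y≤ = bounded y
          β , 0<β , Bβ = shrink B ε 0<B 0<ε
          γ , 0<γ , Cγ = shrink C ε 0<C 0<ε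
          P , k = cauchy y β 0<β
          Q , h = cauchy x γ 0<γ
      in (M ℕ.⊔ N) ℕ.⊔ (P ℕ.⊔ Q) , λ m n ≤m ≤n →
        let (Mm , _) , (Pm , Qm) = max₄ {M} {N} {P} {Q} ≤m
            (_ , Nn) , (Pn , Qn) = max₄ {M} {N} {P} {Q} ≤n
        in product-close {seq x m} {seq y m} {seq x n} {seq y n} {B} {C} {β} {γ}
             0<B 0<C Bβ Cγ (x≤ m Mm) (y≤ n Nn) (k m n Pm Pn) (h m n Qm Qn)

  *-close : ∀ {x x′ y y′} → x ≈ x′ → y ≈ y′ →
    mkℝ (λ n → seq x n ℚ.* seq y n) (*-cauchy x y) ≈
    mkℝ (λ n → seq x′ n ℚ.* seq y′ n) (*-cauchy x′ y′)
  *-close {x} {x′} {y} {y′} x≈ y≈ .close ε 0<ε =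
    let B , 0<B , M , x≤ = bounded x
        C , 0<C , N , y≤ = bounded y′
        β , 0<β , Bβ = shrink B ε 0<B 0<ε
        γ , 0<γ , Cγ = shrink C ε 0<C 0<ε
        P , k = close y≈ β 0<β
        Q , h = close x≈ γ 0<γ
    in (M ℕ.⊔ N) ℕ.⊔ (P ℕ.⊔ Q) , λ n ≤n →
      let (Mn , Nn) , (Pn , Qn) = max₄ {M} {N} {P} {Q} ≤n
      in product-close {seq x n} {seq y n} {seq x′ n} {seq y′ n} {B} {C} {β} {γ}
           0<B 0<C Bβ Cγ (x≤ n Mn) (y≤ n Nn) (k n Pn) (h n Qn)

private abstract
  const-cauchy : ∀ q → Cauchy (λ _ → q)
  const-cauchy q ε 0<ε =
    0 , λ _ _ _ _ → subst (ℚ._< ε) (sym (|p-p|≡0 q)) 0<ε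

infixl 6 _+_ _-_
infixl 7 _*_ _⊓_
infixl 6 _⊔_
infix  8 -_

_+_ _*_ _⊔_ _⊓_ : ℝ → ℝ → ℝ
x + y = mkℝ (λ n → seq x n ℚ.+ seq y n) (cauchy₂ ℚ._+_ +-ne x y)
x * y = mkℝ (λ n → seq x n ℚ.* seq y n) (*-cauchy x y)
x ⊔ y = mkℝ (λ n → seq x n ℚ.⊔ seq y n) (cauchy₂ ℚ._⊔_ ⊔-ne x y)
x ⊓ y = mkℝ (λ n → seq x n ℚ.⊓ seq y n) (cauchy₂ ℚ._⊓_ ⊓-ne x y)

-_ ∣_∣ : ℝ → ℝ
- x   = mkℝ (λ n → ℚ.- seq x n) (cauchy₁ (λ p → ℚ.- p) neg-ne x)
∣ x ∣ = mkℝ (λ n → ℚ.∣ seq x n ∣) (cauchy₁ ℚ.∣_∣ abs-ne x)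

_-_ : ℝ → ℝ → ℝ
x - y = x + (- y)

fromℚ : ℚ → ℝ
fromℚ q = mkℝ (λ _ → q) (const-cauchy q)

fromℕ : ℕ → ℝ
fromℕ k = fromℚ (ℤ.+ k ℚ./ 1)

0ℝ 1ℝ : ℝ
0ℝ = fromℚ 0ℚ
1ℝ = fromℚ 1ℚ

pointwise : ∀ {x y} → (∀ n → seq x n ≡ seq y n) → x ≈ y
pointwise {x} {y} eq .close ε 0<ε = 0 , λ n _ →
  subst (ℚ._< ε)
    (sym (trans (cong (λ z → ℚ.∣ z ℚ.- seq y n ∣) (eq n)) (|p-p|≡0 (seq y n))))
    0<ε

≈-refl : ∀ {x} → x ≈ x
≈-refl = pointwise (λ _ → refl)

≈-sym : ∀ {x y} → x ≈ y → y ≈ x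
≈-sym {x} {y} x≈y .close ε 0<ε with close x≈y ε 0<ε
... | N , h = N , λ n N≤n →
  subst (ℚ._< ε) (|p-q|≡|q-p| (seq x n) (seq y n)) (h n N≤n)

≈-trans : ∀ {x y z} → x ≈ y → y ≈ z → x ≈ z
≈-trans {x} {y} {z} x≈y y≈z .close ε 0<ε
  with close x≈y (½ ℚ.* ε) (0<½* 0<ε) | close y≈z (½ ℚ.* ε) (0<½* 0<ε)
... | M , h | N , k = M ℕ.⊔ N , λ n ≤n → ℚ.≤-<-trans
  (triangle (seq x n) (seq y n) (seq z n))
  (+-<-halves (h n (ℕ.m⊔n≤o⇒m≤o M N ≤n)) (k n (ℕ.m⊔n≤o⇒n≤o M N ≤n)))

+-cong : ∀ {x x′ y y′} → x ≈ x′ → y ≈ y′ → x + y ≈ x′ + y′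
+-cong {x} {x′} {y} {y′} = cong₂′ ℚ._+_ +-ne x x′ y y′

*-cong : ∀ {x x′ y y′} → x ≈ x′ → y ≈ y′ → x * y ≈ x′ * y′
*-cong {x} {x′} {y} {y′} = *-close {x} {x′} {y} {y′}

⊔-cong : ∀ {x x′ y y′} → x ≈ x′ → y ≈ y′ → x ⊔ y ≈ x′ ⊔ y′
⊔-cong {x} {x′} {y} {y′} = cong₂′ ℚ._⊔_ ⊔-ne x x′ y y′

⊓-cong : ∀ {x x′ y y′} → x ≈ x′ → y ≈ y′ → x ⊓ y ≈ x′ ⊓ y′
⊓-cong {x} {x′} {y} {y′} = cong₂′ ℚ._⊓_ ⊓-ne x x′ y y′

-‿cong : ∀ {x y} → x ≈ y → - x ≈ - y
-‿cong {x} {y} = cong₁ (λ p → ℚ.- p) neg-ne x y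

∣-∣-cong : ∀ {x y} → x ≈ y → ∣ x ∣ ≈ ∣ y ∣
∣-∣-cong {x} {y} = cong₁ ℚ.∣_∣ abs-ne x y

+-assoc : ∀ x y z → (x + y) + z ≈ x + (y + z)
+-assoc x y z = pointwise λ n → ℚ.+-assoc (seq x n) (seq y n) (seq z n)

+-comm : ∀ x y → x + y ≈ y + x
+-comm x y = pointwise λ n → ℚ.+-comm (seq x n) (seq y n)

+-identityˡ : ∀ x → 0ℝ + x ≈ x
+-identityˡ x = pointwise λ n → ℚ.+-identityˡ (seq x n)

+-identityʳ : ∀ x → x + 0ℝ ≈ x
+-identityʳ x = pointwise λ n → ℚ.+-identityʳ (seq x n)

-‿inverseˡ : ∀ x → (- x) + x ≈ 0ℝ
-‿inverseˡ x = pointwise λ n → ℚ.+-inverseˡ (seq x n)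

-‿inverseʳ : ∀ x → x + (- x) ≈ 0ℝ
-‿inverseʳ x = pointwise λ n → ℚ.+-inverseʳ (seq x n)

*-assoc : ∀ x y z → (x * y) * z ≈ x * (y * z)
*-assoc x y z = pointwise λ n → ℚ.*-assoc (seq x n) (seq y n) (seq z n)

*-comm : ∀ x y → x * y ≈ y * x
*-comm x y = pointwise λ n → ℚ.*-comm (seq x n) (seq y n)

*-identityˡ : ∀ x → 1ℝ * x ≈ x
*-identityˡ x = pointwise λ n → ℚ.*-identityˡ (seq x n)

*-identityʳ : ∀ x → x * 1ℝ ≈ x
*-identityʳ x = pointwise λ n → ℚ.*-identityʳ (seq x n)

*-distribˡ-+ : ∀ x y z → x * (y + z) ≈ x * y + x * z
*-distribˡ-+ x y z = pointwise λ n → ℚ.*-distribˡ-+ (seq x n) (seq y n) (seq z n)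

*-distribʳ-+ : ∀ x y z → (y + z) * x ≈ y * x + z * x
*-distribʳ-+ x y z = pointwise λ n → ℚ.*-distribʳ-+ (seq x n) (seq y n) (seq z n)

+-*-isCommutativeRing : IsCommutativeRing _≈_ _+_ _*_ (λ x → - x) 0ℝ 1ℝ
+-*-isCommutativeRing = record
  { isRing = record
    { +-isAbelianGroup = record
      { isGroup = record
        { isMonoid = record
          { isSemigroup = record
            { isMagma = record
              { isEquivalence = record
                { refl = ≈-refl ; sym = ≈-sym ; trans = ≈-trans }
              ; ∙-cong = +-cong
              }
            ; assoc = +-assoc
            }
          ; identity = +-identityˡ , +-identityʳ
          }
        ; inverse = -‿inverseˡ , -‿inverseʳ
        ; ⁻¹-cong = -‿cong
        }
      ; comm = +-comm
      }
    ; *-cong = *-cong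
    ; *-assoc = *-assoc
    ; *-identity = *-identityˡ , *-identityʳ
    ; distrib = *-distribˡ-+ , *-distribʳ-+
    }
  ; *-comm = *-comm
  }

+-*-commutativeRing : CommutativeRing 0ℓ 0ℓ
+-*-commutativeRing = record { isCommutativeRing = +-*-isCommutativeRing }

open import Algebra.Properties.CommutativeMonoid.Sum
  (CommutativeRing.+-commutativeMonoid +-*-commutativeRing) public
  using (sum; sum-syntax)

------------------------------------------------------------------------

permutations : ∀ n → List (Permutation′ n)
permutations ℕ.zero    = [ id ]
permutations (ℕ.suc n) =
  concatMap (λ i → map (insert zero i) (permutations n)) (allFin (ℕ.suc n))

-- Permutations are compared pointwise, as there is no function
-- extensionality.
permutations-complete : ∀ {n} (π : Permutation′ n) →
  ∃[ ρ ] ρ ∈ permutations n × ρ ≈ₚ π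
permutations-complete {ℕ.zero}  π = id , here refl , λ ()
permutations-complete {ℕ.suc n} π with permutations-complete (remove zero π)
... | ρ , ρ∈ , ρ≈ =
  insert zero i ρ
  , ∈-concatMap⁺ _ (lose (∈-allFin i) (∈-map⁺ (insert zero i) ρ∈))
  , λ k → trans (insert-cong k) (insert-remove zero π k)
  where
  i = π ⟨$⟩ʳ zero
  insert-cong : insert zero i ρ ≈ₚ insert zero i (remove zero π)
  insert-cong zero    = refl
  insert-cong (suc k) = cong (punchIn i) (ρ≈ k)

-- The folds start from the value at id, which is itself one of the values
-- over which the extremum is taken.
maxₚ minₚ : ∀ {n} → (Permutation′ n → ℝ) → ℝ
maxₚ {n} f = foldr _⊔_ (f id) (map f (permutations n))
minₚ {n} f = foldr _⊓_ (f id) (map f (permutations n))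

------------------------------------------------------------------------

-- The proof argument carries no data: any two proofs of x ≢ y are
-- definitionally equal.
WDigraph : ℕ → Set
WDigraph n = (x y : Fin n) → x ≢ y → ℝ

private
  proof-irrelevant : ∀ {n} (w : WDigraph n) x y (p q : x ≢ y) → w x y p ≡ w x y q
  proof-irrelevant w x y p q = refl

ifDistinct : ∀ {n} {x y : Fin n} → Dec (x ≡ y) → (x ≢ y → ℝ) → ℝ
ifDistinct (yes _)  f = 0ℝ
ifDistinct (no x≢y) f = f x≢y

∑≢ : ∀ {n} → ((x y : Fin n) → x ≢ y → ℝ) → ℝ
∑≢ {n} f = ∑[ x < n ] ∑[ y < n ] ifDistinct (x Fin.≟ y) (f x y)

⟨_,_⟩ : ∀ {n} → WDigraph n → WDigraph n → ℝ
⟨ w , u ⟩ = ∑≢ λ x y x≢y → w x y x≢y * u x y x≢y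

‖_‖₁ : ∀ {n} → WDigraph n → ℝ
‖ w ‖₁ = ∑≢ λ x y x≢y → ∣ w x y x≢y ∣

total : ∀ {n} → WDigraph n → ℝ
total w = ∑≢ w

pairs : ℕ → ℕ
pairs n = n ℕ.* (n ℕ.∸ 1)

pairs-nonZero : ∀ n → .{{NonTrivial n}} → ℕ.NonZero (pairs n)
pairs-nonZero (ℕ.suc (ℕ.suc n)) = _

density : ∀ {n} → .{{NonTrivial n}} → WDigraph n → ℝ
density {n} w = total w * fromℚ ((ℤ.+ 1 ℚ./ pairs n) {{pairs-nonZero n}})

relabel : ∀ {n} → Permutation′ n → WDigraph n → WDigraph n
relabel π w x y x≢y = w (π ⟨$⟩ˡ x) (π ⟨$⟩ˡ y)
  λ eq → x≢y (Injection.injective (↔⇒↣ (flip π)) eq)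

module _ {n} .{{_ : NonTrivial n}} (w u : WDigraph n) where

  disc⁺ disc⁻ disc : ℝ
  disc⁺ = maxₚ (λ π → ⟨ relabel π w , u ⟩) - density w * density u * fromℕ (pairs n)
  disc⁻ = density w * density u * fromℕ (pairs n) - minₚ (λ π → ⟨ relabel π w , u ⟩)
  disc  = disc⁺ ⊔ disc⁻

{-# OPTIONS --safe #-}
-- If ⟨ w_π , u ⟩ vanishes for every π and one of w, u has total 0, then
-- disc(w, u) = 0.  As an Sₙ-module, the space of weighted digraphs of total 0 is
-- a sum of four irreducibles (two of them isomorphic to the standard module),
-- and one weight is taken from each of four mutually orthogonal summands:
-- a(x) + a(y) and a(x) − a(y) with Σ a = 0, a symmetric weight with zero row
-- sums, and an antisymmetric one with zero row sums.  Symmetric weights are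
-- orthogonal to antisymmetric ones, weights c(x) + d(y) are orthogonal to those
-- with zero row and column sums, and relabelling preserves all these shapes.
module Submission where

open import Defs
open import Algebra.Bundles using (CommutativeRing)
open import Data.Fin using (Fin; _<_; zero; suc)
open import Data.Fin.Permutation using (Permutation′; flip; id; _⟨$⟩ˡ_)
import Data.Fin.Properties as Fin
import Data.Integer.Base as ℤ
open import Data.List.Base using (List; []; _∷_; foldr; map)
open import Data.Nat using (ℕ; _≤_; z≤n; s≤s; NonTrivial; n>1⇒nonTrivial)
import Data.Nat as ℕ
open import Data.Nat.Properties using (≤-trans)
open import Data.Product using (Σ-syntax; _×_; _,_)
open import Data.Rational.Base as ℚ using (ℚ; 0ℚ; 1ℚ; ½)
import Data.Rational.Properties as ℚ
open import Data.Rational.Solver using (module +-*-Solver)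
open import Function.Base using (_∘_)
open import Function.Bundles using (Injection)
open import Function.Properties.Inverse using (↔⇒↣)
open import Relation.Binary.PropositionalEquality
  using (_≡_; _≢_; refl; sym; trans; cong; cong₂; subst; module ≡-Reasoning)
open import Relation.Nullary using (contradiction; yes; no)
import Algebra.Properties.Semiring.Sum
  (CommutativeRing.semiring ℚ.+-*-commutativeRing) as ∑ℚ

open +-*-Solver using (solve; _:=_; _:+_; _:*_; :-_; _:-_; con)
open ≡-Reasoning

-- Rational weights and their double sums

Weight : ℕ → Set
Weight n = Fin n → Fin n → ℚ

-- The diagonal is included, so no proofs of `x ≢ y` are carried around; `∑≢-fromℚ` returns to sums
-- over distinct pairs when the diagonal is zero.
∑∑ : ∀ {n} → Weight n → ℚ
∑∑ {n} g = ∑ℚ.sum {n} λ x → ∑ℚ.sum {n} (g x)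

∑∑-cong : ∀ {n} {g h : Weight n} → (∀ x y → g x y ≡ h x y) → ∑∑ g ≡ ∑∑ h
∑∑-cong g≡h = ∑ℚ.sum-cong-≗ λ x → ∑ℚ.sum-cong-≗ (g≡h x)

∑-zero : ∀ {n} {f : Fin n → ℚ} → (∀ x → f x ≡ 0ℚ) → ∑ℚ.sum f ≡ 0ℚ
∑-zero {n} f≡0 = trans (∑ℚ.sum-cong-≗ f≡0) (∑ℚ.sum-replicate-zero n)

∑∑-+ : ∀ {n} (g h : Weight n) → ∑∑ (λ x y → g x y ℚ.+ h x y) ≡ ∑∑ g ℚ.+ ∑∑ h
∑∑-+ g h = trans (∑ℚ.sum-cong-≗ λ x → ∑ℚ.∑-distrib-+ (g x) (h x))
  (∑ℚ.∑-distrib-+ (∑ℚ.sum ∘ g) (∑ℚ.sum ∘ h))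

∑∑-scale : ∀ {n} c (g : Weight n) → ∑∑ (λ x y → c ℚ.* g x y) ≡ c ℚ.* ∑∑ g
∑∑-scale c g = trans
  (∑ℚ.sum-cong-≗ λ x → sym (∑ℚ.*-distribˡ-sum c (g x)))
  (sym (∑ℚ.*-distribˡ-sum c (∑ℚ.sum ∘ g)))

p+p≡0⇒p≡0 : ∀ p → p ℚ.+ p ≡ 0ℚ → p ≡ 0ℚ
p+p≡0⇒p≡0 p eq = begin
  p                  ≡⟨ solve 1 (λ p → p := con ½ :* (p :+ p)) refl p ⟩
  ½ ℚ.* (p ℚ.+ p)    ≡⟨ cong (½ ℚ.*_) eq ⟩
  ½ ℚ.* 0ℚ           ≡⟨ ℚ.*-zeroʳ ½ ⟩
  0ℚ                 ∎

-- Antisymmetry and zero row sums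

Symmetric Antisymmetric ZeroDiagonal ZeroRows : ∀ {n} → Weight n → Set
Symmetric     g = ∀ x y → g x y ≡ g y x
Antisymmetric g = ∀ x y → g x y ≡ ℚ.- g y x
ZeroDiagonal  g = ∀ x → g x x ≡ 0ℚ
ZeroRows      g = ∀ x → ∑ℚ.sum (g x) ≡ 0ℚ

-- Adding to the sum its copy with `x` and `y` exchanged cancels termwise, so twice the sum is 0.
∑∑-antisymmetric : ∀ {n} {g : Weight n} → Antisymmetric g → ∑∑ g ≡ 0ℚ
∑∑-antisymmetric {n} {g} anti = p+p≡0⇒p≡0 (∑∑ g) (begin
  ∑∑ g ℚ.+ ∑∑ g                        ≡⟨ cong (∑∑ g ℚ.+_) (∑ℚ.∑-comm g) ⟩
  ∑∑ g ℚ.+ ∑∑ (λ x y → g y x)          ≡⟨ ∑∑-+ g (λ x y → g y x) ⟨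
  ∑∑ (λ x y → g x y ℚ.+ g y x)         ≡⟨ ∑-zero (λ x → ∑-zero λ y → cancel x y) ⟩
  0ℚ                                   ∎)
  where
  cancel : ∀ x y → g x y ℚ.+ g y x ≡ 0ℚ
  cancel x y = trans (cong (ℚ._+ g y x) (anti x y)) (ℚ.+-inverseˡ (g y x))

∑-rows : ∀ {n} (c : Fin n → ℚ) {h : Weight n} → ZeroRows h →
  ∑∑ (λ x y → c x ℚ.* h x y) ≡ 0ℚ
∑-rows c {h} rows = ∑-zero λ x → begin
  ∑ℚ.sum (λ y → c x ℚ.* h x y)  ≡⟨ ∑ℚ.*-distribˡ-sum (c x) (h x) ⟨
  c x ℚ.* ∑ℚ.sum (h x)          ≡⟨ cong (c x ℚ.*_) (rows x) ⟩
  c x ℚ.* 0ℚ                    ≡⟨ ℚ.*-zeroʳ (c x) ⟩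
  0ℚ                            ∎

-- After distributing, the `c` part vanishes row by row and, with the summation order exchanged, the
-- `d` part vanishes column by column.
∑-rows+columns : ∀ {n} (c d : Fin n → ℚ) {h : Weight n} →
  ZeroRows h → ZeroRows (λ x y → h y x) →
  ∑∑ (λ x y → (c x ℚ.+ d y) ℚ.* h x y) ≡ 0ℚ
∑-rows+columns c d {h} rows columns = begin
  ∑∑ (λ x y → (c x ℚ.+ d y) ℚ.* h x y)
    ≡⟨ ∑∑-cong (λ x y → ℚ.*-distribʳ-+ (h x y) (c x) (d y)) ⟩
  ∑∑ (λ x y → c x ℚ.* h x y ℚ.+ d y ℚ.* h x y)
    ≡⟨ ∑∑-+ (λ x y → c x ℚ.* h x y) (λ x y → d y ℚ.* h x y) ⟩
  ∑∑ (λ x y → c x ℚ.* h x y) ℚ.+ ∑∑ (λ x y → d y ℚ.* h x y)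
    ≡⟨ cong₂ ℚ._+_ (∑-rows c rows)
         (trans (∑ℚ.∑-comm (λ x y → d y ℚ.* h x y)) (∑-rows d columns)) ⟩
  0ℚ ∎

-- Positivity of sums

∑-nonNegative : ∀ {n} {f : Fin n → ℚ} → (∀ x → 0ℚ ℚ.≤ f x) → 0ℚ ℚ.≤ ∑ℚ.sum f
∑-nonNegative {ℕ.zero}  0≤f = ℚ.≤-refl
∑-nonNegative {ℕ.suc n} 0≤f = ℚ.+-mono-≤ (0≤f zero) (∑-nonNegative (0≤f ∘ suc))

∑-positive : ∀ {n} {f : Fin n → ℚ} → (∀ x → 0ℚ ℚ.≤ f x) →
  ∀ i → 0ℚ ℚ.< f i → 0ℚ ℚ.< ∑ℚ.sum f
∑-positive 0≤f zero    0<fi = ℚ.+-mono-<-≤ 0<fi (∑-nonNegative (0≤f ∘ suc))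
∑-positive 0≤f (suc i) 0<fi = ℚ.+-mono-≤-< (0≤f zero) (∑-positive (0≤f ∘ suc) i 0<fi)

-- From rational weights to real digraphs

sum-fromℚ : ∀ {n} {f : Fin n → ℝ} {g : Fin n → ℚ} →
  (∀ x → f x ≈ fromℚ (g x)) → sum f ≈ fromℚ (∑ℚ.sum g)
sum-fromℚ {ℕ.zero}  f≈g = ≈-refl
sum-fromℚ {ℕ.suc n} f≈g =
  ≈-trans (+-cong (f≈g zero) (sum-fromℚ (f≈g ∘ suc))) (pointwise λ _ → refl)

∑≢-fromℚ : ∀ {n} {f : (x y : Fin n) → x ≢ y → ℝ} {g : Weight n} →
  ZeroDiagonal g → (∀ x y x≢y → f x y x≢y ≈ fromℚ (g x y)) → ∑≢ f ≈ fromℚ (∑∑ g)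
∑≢-fromℚ {f = f} {g} g≡0 f≈g = sum-fromℚ λ x → sum-fromℚ λ y → entry x y
  where
  entry : ∀ x y → ifDistinct (x Fin.≟ y) (f x y) ≈ fromℚ (g x y)
  entry x y with x Fin.≟ y
  ... | yes refl = pointwise λ _ → sym (g≡0 x)
  ... | no  x≢y  = f≈g x y x≢y

toWDigraph : ∀ {n} → Weight n → WDigraph n
toWDigraph g x y _ = fromℚ (g x y)

norm : ∀ {n} → Weight n → ℚ
norm g = ∑∑ λ x y → ℚ.∣ g x y ∣

-- Every relabelling of `g` is tested, so this says that `h` is orthogonal to the whole submodule
-- generated by `g`.
Orthogonal : ∀ {n} → Weight n → Weight n → Set
Orthogonal {n} g h = ∀ (π : Permutation′ n) →
  ∑∑ (λ x y → g (π ⟨$⟩ˡ x) (π ⟨$⟩ˡ y) ℚ.* h x y) ≡ 0ℚ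

total≈0 : ∀ {n} {g : Weight n} → ZeroDiagonal g → ∑∑ g ≡ 0ℚ →
  total (toWDigraph g) ≈ 0ℝ
total≈0 diag ∑g≡0 =
  ≈-trans (∑≢-fromℚ diag λ _ _ _ → ≈-refl) (pointwise λ _ → ∑g≡0)

⟨relabel⟩≈0 : ∀ {n} {g h : Weight n} → ZeroDiagonal h → Orthogonal g h →
  ∀ π → ⟨ relabel π (toWDigraph g) , toWDigraph h ⟩ ≈ 0ℝ
⟨relabel⟩≈0 {g = g} diag g⊥h π = ≈-trans
  (∑≢-fromℚ
    (λ x → trans (cong (g (π ⟨$⟩ˡ x) (π ⟨$⟩ˡ x) ℚ.*_) (diag x))
             (ℚ.*-zeroʳ (g (π ⟨$⟩ˡ x) (π ⟨$⟩ˡ x))))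
    (λ _ _ _ → pointwise λ _ → refl))
  (pointwise λ _ → g⊥h π)

-- Vanishing of the discrepancy

foldr≈0 : ∀ {A : Set} {_∙_ : ℝ → ℝ → ℝ} →
  (∀ {x y} → x ≈ 0ℝ → y ≈ 0ℝ → x ∙ y ≈ 0ℝ) →
  ∀ {f : A → ℝ} {e} → e ≈ 0ℝ → (∀ a → f a ≈ 0ℝ) →
  ∀ as → foldr _∙_ e (map f as) ≈ 0ℝ
foldr≈0 ∙≈0 e≈0 f≈0 []       = e≈0
foldr≈0 ∙≈0 e≈0 f≈0 (a ∷ as) =
  ∙≈0 (f≈0 a) (foldr≈0 ∙≈0 e≈0 f≈0 as)

⊔≈0 : ∀ {x y} → x ≈ 0ℝ → y ≈ 0ℝ → x ⊔ y ≈ 0ℝ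
⊔≈0 x≈0 y≈0 = ≈-trans (⊔-cong x≈0 y≈0) (pointwise λ _ → refl)

⊓≈0 : ∀ {x y} → x ≈ 0ℝ → y ≈ 0ℝ → x ⊓ y ≈ 0ℝ
⊓≈0 x≈0 y≈0 = ≈-trans (⊓-cong x≈0 y≈0) (pointwise λ _ → refl)

-- The maximum and the minimum are folds over values that are all 0, and the zero density of `w`
-- kills the mean term.
disc≈0 : ∀ {n} .{{_ : NonTrivial n}} (w u : WDigraph n) → total w ≈ 0ℝ →
  (∀ π → ⟨ relabel π w , u ⟩ ≈ 0ℝ) → disc w u ≈ 0ℝ
disc≈0 {n} w u w≈0 w⊥u = ⊔≈0
  (difference (foldr≈0 ⊔≈0 (w⊥u id) w⊥u (permutations n)) mean≈0)
  (difference mean≈0 (foldr≈0 ⊓≈0 (w⊥u id) w⊥u (permutations n)))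
  where
  difference : ∀ {x y} → x ≈ 0ℝ → y ≈ 0ℝ → x - y ≈ 0ℝ
  difference x≈0 y≈0 = ≈-trans (+-cong x≈0 (-‿cong y≈0)) (pointwise λ _ → refl)

  0*≈0 : ∀ {x} y → x ≈ 0ℝ → x * y ≈ 0ℝ
  0*≈0 y x≈0 = ≈-trans (*-cong x≈0 (≈-refl {y}))
    (pointwise λ k → ℚ.*-zeroˡ (seq y k))

  mean≈0 : density w * density u * fromℕ (pairs n) ≈ 0ℝ
  mean≈0 = 0*≈0 (fromℕ (pairs n)) (0*≈0 (density u) (0*≈0 _ w≈0))

-- Scaling to the prescribed norm

record Balanced {n} (g : Weight n) : Set where
  field
    zeroDiagonal : ZeroDiagonal g
    total≡0      : ∑∑ g ≡ 0ℚ
    0<norm       : 0ℚ ℚ.< norm g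
open Balanced

module Normalised {n} {g : Weight n} (bal : Balanced g) where

  instance
    norm-pos : ℚ.Positive (norm g)
    norm-pos = ℚ.positive (0<norm bal)

    norm-nonZero : ℚ.NonZero (norm g)
    norm-nonZero = ℚ.pos⇒nonZero (norm g)

  -- Multiplication by `factor` turns the norm of `g` into `pairs n` and preserves zero total and
  -- zero diagonal.
  norm⁻¹ factor : ℚ
  norm⁻¹ = ℚ.1/ norm g
  factor = (ℤ.+ pairs n ℚ./ 1) ℚ.* norm⁻¹

  factor-nonNegative : 0ℚ ℚ.≤ factor
  factor-nonNegative = ℚ.nonNegative⁻¹ factor
    {{ℚ.nonNeg*nonNeg⇒nonNeg (ℤ.+ pairs n ℚ./ 1) {{ℚ.normalize-nonNeg (pairs n) 1}}
      norm⁻¹ {{ℚ.pos⇒nonNeg norm⁻¹ {{ℚ.1/pos⇒pos (norm g)}}}}}}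

  weight : Weight n
  weight x y = factor ℚ.* g x y

  diagonal : ZeroDiagonal weight
  diagonal x = trans (cong (factor ℚ.*_) (zeroDiagonal bal x)) (ℚ.*-zeroʳ factor)

  normalised : WDigraph n
  normalised = toWDigraph weight

  total-normalised : total normalised ≈ 0ℝ
  total-normalised = total≈0 diagonal (begin
    ∑∑ weight         ≡⟨ ∑∑-scale factor g ⟩
    factor ℚ.* ∑∑ g   ≡⟨ cong (factor ℚ.*_) (total≡0 bal) ⟩
    factor ℚ.* 0ℚ     ≡⟨ ℚ.*-zeroʳ factor ⟩
    0ℚ                ∎)

  norm-weight : norm weight ≡ ℤ.+ pairs n ℚ./ 1
  norm-weight = begin
    norm weight
      ≡⟨ ∑∑-cong (λ x y → trans (ℚ.∣p*q∣≡∣p∣*∣q∣ factor (g x y))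
           (cong (ℚ._* ℚ.∣ g x y ∣) (ℚ.0≤p⇒∣p∣≡p factor-nonNegative))) ⟩
    ∑∑ (λ x y → factor ℚ.* ℚ.∣ g x y ∣)
      ≡⟨ ∑∑-scale factor (λ x y → ℚ.∣ g x y ∣) ⟩
    factor ℚ.* norm g
      ≡⟨ ℚ.*-assoc (ℤ.+ pairs n ℚ./ 1) norm⁻¹ (norm g) ⟩
    (ℤ.+ pairs n ℚ./ 1) ℚ.* (norm⁻¹ ℚ.* norm g)
      ≡⟨ cong ((ℤ.+ pairs n ℚ./ 1) ℚ.*_) (ℚ.*-inverseˡ (norm g)) ⟩
    (ℤ.+ pairs n ℚ./ 1) ℚ.* 1ℚ
      ≡⟨ ℚ.*-identityʳ (ℤ.+ pairs n ℚ./ 1) ⟩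
    ℤ.+ pairs n ℚ./ 1 ∎

  ‖normalised‖ : ‖ normalised ‖₁ ≈ fromℕ (pairs n)
  ‖normalised‖ = ≈-trans
    (∑≢-fromℚ (λ x → cong ℚ.∣_∣ (diagonal x)) (λ _ _ _ → pointwise λ _ → refl))
    (pointwise λ _ → norm-weight)

open Normalised using (normalised; total-normalised; ‖normalised‖)

-- The pairing is bilinear, so both scaling factors come out of the sum and orthogonality survives
-- normalisation.
disc-normalised : ∀ {n} .{{_ : NonTrivial n}} {g h : Weight n}
  (bg : Balanced g) (bh : Balanced h) → Orthogonal g h →
  disc (normalised bg) (normalised bh) ≈ 0ℝ
disc-normalised {g = g} {h} bg bh g⊥h =
  disc≈0 (normalised bg) (normalised bh) (total-normalised bg)
    (⟨relabel⟩≈0 {g = G.weight} {H.weight} H.diagonal scaled)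
  where
  module G = Normalised bg
  module H = Normalised bh
  scaled : Orthogonal G.weight H.weight
  scaled π = begin
    ∑∑ (λ x y → (G.factor ℚ.* gπ x y) ℚ.* (H.factor ℚ.* h x y))
      ≡⟨ ∑∑-cong (λ x y → solve 4 (λ c p d q →
           (c :* p) :* (d :* q) := (c :* d) :* (p :* q))
           refl G.factor (gπ x y) H.factor (h x y)) ⟩
    ∑∑ (λ x y → (G.factor ℚ.* H.factor) ℚ.* (gπ x y ℚ.* h x y))
      ≡⟨ ∑∑-scale (G.factor ℚ.* H.factor) (λ x y → gπ x y ℚ.* h x y) ⟩
    (G.factor ℚ.* H.factor) ℚ.* ∑∑ (λ x y → gπ x y ℚ.* h x y)
      ≡⟨ cong ((G.factor ℚ.* H.factor) ℚ.*_) (g⊥h π) ⟩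
    (G.factor ℚ.* H.factor) ℚ.* 0ℚ
      ≡⟨ ℚ.*-zeroʳ (G.factor ℚ.* H.factor) ⟩
    0ℚ ∎
    where
    gπ : Weight _
    gπ x y = g (π ⟨$⟩ˡ x) (π ⟨$⟩ˡ y)

-- Orthogonality between shapes of weights

-- Relabelling preserves symmetry, and the entrywise product of a symmetric and an antisymmetric
-- weight is antisymmetric, hence sums to 0.
symmetric⊥antisymmetric : ∀ {n} {g h : Weight n} →
  Symmetric g → Antisymmetric h → Orthogonal g h
symmetric⊥antisymmetric {g = g} {h} symm anti π = ∑∑-antisymmetric λ x y →
  trans (cong₂ ℚ._*_ (symm (π ⟨$⟩ˡ x) (π ⟨$⟩ˡ y)) (anti x y))
    (sym (ℚ.neg-distribʳ-* (g (π ⟨$⟩ˡ y) (π ⟨$⟩ˡ x)) (h y x)))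

antisymmetric⊥symmetric : ∀ {n} {g h : Weight n} →
  Antisymmetric g → Symmetric h → Orthogonal g h
antisymmetric⊥symmetric {g = g} {h} anti symm π = ∑∑-antisymmetric λ x y →
  trans (cong₂ ℚ._*_ (anti (π ⟨$⟩ˡ x) (π ⟨$⟩ˡ y)) (symm x y))
    (sym (ℚ.neg-distribˡ-* (g (π ⟨$⟩ˡ y) (π ⟨$⟩ˡ x)) (h y x)))

-- Relabelling turns `c` and `d` into their composites with the inverse of `π`, so the additive
-- shape persists. It is assumed off the diagonal only; on the diagonal `h` vanishes.
additive⊥zeroRows : ∀ {n} {g h : Weight n} (c d : Fin n → ℚ) →
  (∀ x y → x ≢ y → g x y ≡ c x ℚ.+ d y) →
  ZeroDiagonal h → ZeroRows h → ZeroRows (λ x y → h y x) → Orthogonal g h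
additive⊥zeroRows {g = g} {h} c d g≡c+d diag rows columns π = trans
  (∑∑-cong entry)
  (∑-rows+columns (λ x → c (π ⟨$⟩ˡ x)) (λ y → d (π ⟨$⟩ˡ y)) rows columns)
  where
  entry : ∀ x y → g (π ⟨$⟩ˡ x) (π ⟨$⟩ˡ y) ℚ.* h x y
    ≡ (c (π ⟨$⟩ˡ x) ℚ.+ d (π ⟨$⟩ˡ y)) ℚ.* h x y
  entry x y with x Fin.≟ y
  ... | no x≢y = cong (ℚ._* h x y)
        -- The inverse of `π` is injective, so distinct vertices stay distinct.
        (g≡c+d _ _ (x≢y ∘ Injection.injective (↔⇒↣ (flip π))))
  ... | yes refl = begin
    g πx πx ℚ.* h x x          ≡⟨ cong (g πx πx ℚ.*_) (diag x) ⟩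
    g πx πx ℚ.* 0ℚ             ≡⟨ ℚ.*-zeroʳ (g πx πx) ⟩
    0ℚ                         ≡⟨ ℚ.*-zeroʳ (c πx ℚ.+ d πx) ⟨
    (c πx ℚ.+ d πx) ℚ.* 0ℚ     ≡⟨ cong ((c πx ℚ.+ d πx) ℚ.*_) (diag x) ⟨
    (c πx ℚ.+ d πx) ℚ.* h x x  ∎
    where πx = π ⟨$⟩ˡ x

-- Symmetric and exterior products of vectors

infix 7 _⊙_ _∧_

_⊙_ _∧_ : ∀ {n} → (Fin n → ℚ) → (Fin n → ℚ) → Weight n
(a ⊙ b) x y = a x ℚ.* b y ℚ.+ b x ℚ.* a y
(a ∧ b) x y = a x ℚ.* b y ℚ.- b x ℚ.* a y

⊙-symmetric : ∀ {n} (a b : Fin n → ℚ) → Symmetric (a ⊙ b)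
⊙-symmetric a b x y = solve 4
  (λ ax ay bx by → ax :* by :+ bx :* ay := ay :* bx :+ by :* ax)
  refl (a x) (a y) (b x) (b y)

∧-antisymmetric : ∀ {n} (a b : Fin n → ℚ) → Antisymmetric (a ∧ b)
∧-antisymmetric a b x y = solve 4
  (λ ax ay bx by → ax :* by :- bx :* ay := :- (ay :* bx :- by :* ax))
  refl (a x) (a y) (b x) (b y)

-- Row `x` of `a ⊙ b` or `a ∧ b` is a combination of `b` and `a` with coefficients `a x` and plus or
-- minus `b x`.
∑-linear : ∀ {n} (p q : ℚ) (a b : Fin n → ℚ) → ∑ℚ.sum a ≡ 0ℚ → ∑ℚ.sum b ≡ 0ℚ →
  ∑ℚ.sum (λ y → p ℚ.* a y ℚ.+ q ℚ.* b y) ≡ 0ℚ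
∑-linear p q a b ∑a≡0 ∑b≡0 = begin
  ∑ℚ.sum (λ y → p ℚ.* a y ℚ.+ q ℚ.* b y)
    ≡⟨ ∑ℚ.∑-distrib-+ (λ y → p ℚ.* a y) (λ y → q ℚ.* b y) ⟩
  ∑ℚ.sum (λ y → p ℚ.* a y) ℚ.+ ∑ℚ.sum (λ y → q ℚ.* b y)
    ≡⟨ cong₂ ℚ._+_ (∑ℚ.*-distribˡ-sum p a) (∑ℚ.*-distribˡ-sum q b) ⟨
  p ℚ.* ∑ℚ.sum a ℚ.+ q ℚ.* ∑ℚ.sum b
    ≡⟨ cong₂ (λ s t → p ℚ.* s ℚ.+ q ℚ.* t) ∑a≡0 ∑b≡0 ⟩
  p ℚ.* 0ℚ ℚ.+ q ℚ.* 0ℚ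
    ≡⟨ solve 2 (λ p q → p :* con 0ℚ :+ q :* con 0ℚ := con 0ℚ) refl p q ⟩
  0ℚ ∎

⊙-zeroRows : ∀ {n} (a b : Fin n → ℚ) → ∑ℚ.sum a ≡ 0ℚ → ∑ℚ.sum b ≡ 0ℚ →
  ZeroRows (a ⊙ b)
⊙-zeroRows a b ∑a≡0 ∑b≡0 x = ∑-linear (a x) (b x) b a ∑b≡0 ∑a≡0

∧-zeroRows : ∀ {n} (a b : Fin n → ℚ) → ∑ℚ.sum a ≡ 0ℚ → ∑ℚ.sum b ≡ 0ℚ →
  ZeroRows (a ∧ b)
∧-zeroRows a b ∑a≡0 ∑b≡0 x = trans
  (∑ℚ.sum-cong-≗ λ y → cong (a x ℚ.* b y ℚ.+_) (ℚ.neg-distribˡ-* (b x) (a y)))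
  (∑-linear (a x) (ℚ.- b x) b a ∑b≡0 ∑a≡0)

∧-zeroDiagonal : ∀ {n} (a b : Fin n → ℚ) → ZeroDiagonal (a ∧ b)
∧-zeroDiagonal a b x =
  solve 2 (λ p q → p :* q :- q :* p := con 0ℚ) refl (a x) (b x)

-- The total is twice the product of the sums of `a` and `b`. One zero factor is enough, which
-- covers `a ⊙ e`, where `e` has positive sum.
∑∑-⊙ : ∀ {n} (a b : Fin n → ℚ) → ∑ℚ.sum a ≡ 0ℚ → ∑∑ (a ⊙ b) ≡ 0ℚ
∑∑-⊙ a b ∑a≡0 = begin
  ∑∑ (a ⊙ b)
    ≡⟨ ∑∑-+ (λ x y → a x ℚ.* b y) (λ x y → b x ℚ.* a y) ⟩
  ∑∑ (λ x y → a x ℚ.* b y) ℚ.+ ∑∑ (λ x y → b x ℚ.* a y)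
    ≡⟨ cong (ℚ._+ ∑∑ (λ x y → b x ℚ.* a y))
         (trans (∑ℚ.∑-comm (λ x y → a x ℚ.* b y))
           (∑∑-cong λ x y → ℚ.*-comm (a y) (b x))) ⟩
  ∑∑ (λ x y → b x ℚ.* a y) ℚ.+ ∑∑ (λ x y → b x ℚ.* a y)
    ≡⟨ cong₂ ℚ._+_ (∑-rows b (λ _ → ∑a≡0)) (∑-rows b (λ _ → ∑a≡0)) ⟩
  0ℚ ∎

norm-positive : ∀ {n} (g : Weight n) i j → 0ℚ ℚ.< g i j → 0ℚ ℚ.< norm g
norm-positive g i j 0<gij = ∑-positive
  (λ x → ∑-nonNegative λ y → ℚ.0≤∣p∣ (g x y)) i
  (∑-positive (λ y → ℚ.0≤∣p∣ (g i y)) j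
    (subst (0ℚ ℚ.<_) (sym (ℚ.0≤p⇒∣p∣≡p (ℚ.<⇒≤ 0<gij))) 0<gij))

-- The four weights on at least four vertices

module _ {m : ℕ} where

  private
    n = 4 ℕ.+ m

  -- `a` and `b` are differences of two unit vectors with disjoint supports, which gives `a ⊙ b` a
  -- zero diagonal; this takes four vertices. `e` is the indicator of the complement of the support
  -- of `a`.
  a b e one : Fin n → ℚ
  a zero                = 1ℚ
  a (suc zero)          = ℚ.- 1ℚ
  a (suc (suc _))       = 0ℚ

  b zero                      = 0ℚ
  b (suc zero)                = 0ℚ
  b (suc (suc zero))          = 1ℚ
  b (suc (suc (suc zero)))    = ℚ.- 1ℚ
  b (suc (suc (suc (suc _)))) = 0ℚ

  e zero          = 0ℚ
  e (suc zero)    = 0ℚ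
  e (suc (suc _)) = 1ℚ

  one _ = 1ℚ

  ∑a≡0 : ∑ℚ.sum a ≡ 0ℚ
  ∑a≡0 = cong (λ s → 1ℚ ℚ.+ (ℚ.- 1ℚ ℚ.+ s)) (∑ℚ.sum-replicate-zero (2 ℕ.+ m))

  ∑b≡0 : ∑ℚ.sum b ≡ 0ℚ
  ∑b≡0 = cong (λ s → 0ℚ ℚ.+ (0ℚ ℚ.+ (1ℚ ℚ.+ (ℚ.- 1ℚ ℚ.+ s))))
    (∑ℚ.sum-replicate-zero m)

  -- e = 1 − a², so a(x) e(y) + e(x) a(y) = (a(x) + a(y)) (1 − a(x) a(y)); if
  -- x ≠ y and a(x) a(y) ≠ 0, then a(x) + a(y) = 0.
  a⊙e-additive : ∀ x y → x ≢ y → (a ⊙ e) x y ≡ a x ℚ.+ a y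
  a⊙e-additive zero          zero          x≢y = contradiction refl x≢y
  a⊙e-additive zero          (suc zero)    _   = refl
  a⊙e-additive zero          (suc (suc _)) _   = refl
  a⊙e-additive (suc zero)    zero          _   = refl
  a⊙e-additive (suc zero)    (suc zero)    x≢y = contradiction refl x≢y
  a⊙e-additive (suc zero)    (suc (suc _)) _   = refl
  a⊙e-additive (suc (suc _)) zero          _   = refl
  a⊙e-additive (suc (suc _)) (suc zero)    _   = refl
  a⊙e-additive (suc (suc _)) (suc (suc _)) _   = refl

  a∧one-additive : ∀ x y → x ≢ y → (a ∧ one) x y ≡ a x ℚ.+ ℚ.- a y
  a∧one-additive x y _ = solve 2
    (λ p q → p :* con 1ℚ :- con 1ℚ :* q := p :+ :- q) refl (a x) (a y)

  a⊙e-zeroDiagonal : ZeroDiagonal (a ⊙ e)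
  a⊙e-zeroDiagonal zero          = refl
  a⊙e-zeroDiagonal (suc zero)    = refl
  a⊙e-zeroDiagonal (suc (suc _)) = refl

  a⊙b-zeroDiagonal : ZeroDiagonal (a ⊙ b)
  a⊙b-zeroDiagonal zero                      = refl
  a⊙b-zeroDiagonal (suc zero)                = refl
  a⊙b-zeroDiagonal (suc (suc zero))          = refl
  a⊙b-zeroDiagonal (suc (suc (suc zero)))    = refl
  a⊙b-zeroDiagonal (suc (suc (suc (suc _)))) = refl

  -- At vertices 0 and 2 `a` takes the values 1 and 0, so this entry equals `c` at vertex 2, which
  -- is 1 for both `e` and `b`.
  ⊙-balanced : ∀ c → ZeroDiagonal (a ⊙ c) → 0ℚ ℚ.< (a ⊙ c) zero (suc (suc zero)) →
    Balanced (a ⊙ c)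
  ⊙-balanced c diag pos = record
    { zeroDiagonal = diag
    ; total≡0      = ∑∑-⊙ a c ∑a≡0
    ; 0<norm       = norm-positive (a ⊙ c) zero (suc (suc zero)) pos
    }

  ∧-balanced : ∀ c → 0ℚ ℚ.< (a ∧ c) zero (suc (suc zero)) → Balanced (a ∧ c)
  ∧-balanced c pos = record
    { zeroDiagonal = ∧-zeroDiagonal a c
    ; total≡0      = ∑∑-antisymmetric (∧-antisymmetric a c)
    ; 0<norm       = norm-positive (a ∧ c) zero (suc (suc zero)) pos
    }

  weights : Fin 4 → Weight n
  weights zero                   = a ⊙ e
  weights (suc zero)             = a ∧ one
  weights (suc (suc zero))       = a ⊙ b
  weights (suc (suc (suc zero))) = a ∧ b

  balanced : ∀ i → Balanced (weights i)
  balanced zero                   = ⊙-balanced e a⊙e-zeroDiagonal (ℚ.positive⁻¹ 1ℚ)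
  balanced (suc zero)             = ∧-balanced one (ℚ.positive⁻¹ 1ℚ)
  balanced (suc (suc zero))       = ⊙-balanced b a⊙b-zeroDiagonal (ℚ.positive⁻¹ 1ℚ)
  balanced (suc (suc (suc zero))) = ∧-balanced b (ℚ.positive⁻¹ 1ℚ)

  -- Four of the six pairs have opposite symmetry. The two symmetric weights, and likewise the two
  -- antisymmetric ones, are separated by additive shape against zero row and column sums.
  orthogonal : ∀ i j → i < j → Orthogonal (weights i) (weights j)
  orthogonal zero (suc zero) _ =
    symmetric⊥antisymmetric (⊙-symmetric a e) (∧-antisymmetric a one)
  orthogonal zero (suc (suc zero)) _ =
    additive⊥zeroRows {h = a ⊙ b} a a a⊙e-additive a⊙b-zeroDiagonal
      (⊙-zeroRows a b ∑a≡0 ∑b≡0)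
      (λ x → trans (∑ℚ.sum-cong-≗ λ y → ⊙-symmetric a b y x)
               (⊙-zeroRows a b ∑a≡0 ∑b≡0 x))
  orthogonal zero (suc (suc (suc zero))) _ =
    symmetric⊥antisymmetric (⊙-symmetric a e) (∧-antisymmetric a b)
  orthogonal (suc zero) (suc (suc zero)) _ =
    antisymmetric⊥symmetric (∧-antisymmetric a one) (⊙-symmetric a b)
  orthogonal (suc zero) (suc (suc (suc zero))) _ =
    additive⊥zeroRows {h = a ∧ b} a (λ y → ℚ.- a y)
      a∧one-additive (∧-zeroDiagonal a b)
      (∧-zeroRows a b ∑a≡0 ∑b≡0)
      -- The columns of `a ∧ b` are the rows of `b ∧ a`.
      (λ x → trans (∑ℚ.sum-cong-≗ λ y → ∧-transpose y x)
               (∧-zeroRows b a ∑b≡0 ∑a≡0 x))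
    where
    ∧-transpose : ∀ y x → (a ∧ b) y x ≡ (b ∧ a) x y
    ∧-transpose y x = solve 4
      (λ ax ay bx by → ay :* bx :- by :* ax := bx :* ay :- ax :* by)
      refl (a x) (a y) (b x) (b y)
  orthogonal (suc (suc zero)) (suc (suc (suc zero))) _ =
    symmetric⊥antisymmetric (⊙-symmetric a b) (∧-antisymmetric a b)
  orthogonal (suc zero)             (suc zero)             (s≤s ())
  orthogonal (suc (suc zero))       (suc zero)             (s≤s ())
  orthogonal (suc (suc zero))       (suc (suc zero))       (s≤s (s≤s ()))
  orthogonal (suc (suc (suc zero))) (suc zero)             (s≤s ())
  orthogonal (suc (suc (suc zero))) (suc (suc zero))       (s≤s (s≤s ()))
  orthogonal (suc (suc (suc zero))) (suc (suc (suc zero))) (s≤s (s≤s (s≤s ())))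

  abstract
    graphs : Fin 4 → WDigraph n
    graphs i = normalised (balanced i)

    total-graphs : ∀ i → total (graphs i) ≈ 0ℝ
    total-graphs i = total-normalised {g = weights i} (balanced i)

    ‖graphs‖ : ∀ i → ‖ graphs i ‖₁ ≈ fromℕ (pairs n)
    ‖graphs‖ i = ‖normalised‖ {g = weights i} (balanced i)

    disc-graphs : .{{_ : NonTrivial n}} → ∀ i j → i < j →
      disc (graphs i) (graphs j) ≈ 0ℝ
    disc-graphs i j i<j = disc-normalised {g = weights i} {weights j}
      (balanced i) (balanced j) (orthogonal i j i<j)

theorem1p5 : (n : ℕ) (n≥4 : 4 ≤ n) →
    let instance
          n-nonTrivial : NonTrivial n
          n-nonTrivial = n>1⇒nonTrivial (≤-trans (s≤s (s≤s z≤n)) n≥4)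
    in
    Σ[ w ∈ (Fin 4 → WDigraph n) ]
           ((i : Fin 4) → total (w i) ≈ 0ℝ × ‖ w i ‖₁ ≈ fromℕ (pairs n))
         × ((i j : Fin 4) → i < j → disc (w i) (w j) ≈ 0ℝ)
-- Matching on the bound writes `n` as `4 ℕ.+ m`, making the four special vertices explicit.
theorem1p5 .(4 ℕ.+ m) (s≤s (s≤s (s≤s (s≤s {n = m} z≤n)))) =
  graphs {m}
  , (λ i → total-graphs {m} i , ‖graphs‖ {m} i)
  , disc-graphs {m}
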